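{- Let $r \geq 3$ be a fixed integer and $F$ a graph with chromatic number $\chi(F) \leq r$. Then there is a positive constant $C$, depending on $r$ and $F$, such that \[ \mathrm{ex}_r ( n , F^+) \leq C n^{ r- 1 /x^{r - 1} }, \quad\text{where } x = \binom{r}{2} |V(F)|^2 + |V(F)|. \]
   Context: The $r$-uniform expansion $F^+$ of a graph $F$ is obtained by replacing each edge $e$ of $F$ by $e\cup S_e$, where the $S_e$ are sets of $r-2$ new vertices not in $V(F)$, pairwise disjoint for distinct edges. $\mathrm{ex}_r(n,F^+)$ is the maximum number of edges in an $n$-vertex $r$-uniform hypergraph with no subhypergraph isomorphic to $F^+$. -}

module Defs where

open import Data.Fin using (Fin; zero; suc)
open import Data.Fin.Subset using (Subset; _∈_; ∣_∣; ⊤; ⊥; inside; outside)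
open import Data.Fin.Subset.Properties using (∣⊤∣≡n; ∣⊥∣≡0)
open import Data.List using (List; _∷_; length; lookup; tabulate)
open import Data.List.Membership.Propositional using () renaming (_∈_ to _∈ˡ_)
open import Data.List.Membership.Propositional.Properties using (∈-lookup)
open import Data.List.Relation.Unary.All as All using (All)
import Data.List.Relation.Unary.All.Properties as All
open import Data.List.Relation.Unary.AllPairs using (_∷_)
open import Data.List.Relation.Unary.Unique.Propositional using (Unique)
import Data.List.Relation.Unary.Unique.Propositional.Properties as Unique
open import Data.Nat using (ℕ; zero; suc; _+_; _*_; _∸_; _^_; _≤_)
open import Data.Nat.Properties using (+-identityʳ; m+[n∸m]≡n)
open import Data.Product using (Σ-syntax; ∃-syntax; _×_)
open import Data.Vec using ([]; _∷_; _++_; concat; replicate; _[_]≔_)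
open import Data.Vec.Properties using (++-injectiveˡ)
open import Function using (_⇔_)
open import Function.Definitions using (Injective)
open import Relation.Binary.PropositionalEquality
  using (_≡_; _≢_; refl; sym; trans; cong; cong₂)
open import Relation.Nullary using (¬_; contradiction)

private
  variable
    A : Set
    a b n r v : ℕ

-- Duplicate-freeness makes the list a set of edges, so that its length is the
-- number of edges.
record Hypergraph (r n : ℕ) : Set where
  field
    edges   : List (Subset n)
    unique  : Unique edges
    uniform : All (λ e → ∣ e ∣ ≡ r) edges

open Hypergraph public

size : Hypergraph r n → ℕ
size H = length (edges H)

Graph : ℕ → Set
Graph v = Hypergraph 2 v

Colourable : Graph v → ℕ → Set
Colourable {v} F k =
  Σ[ c ∈ (Fin v → Fin k) ]
    (∀ {e} → e ∈ˡ edges F → ∀ {x y} → x ∈ e → y ∈ e → x ≢ y → c x ≢ c y)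

IsChromaticNumber : Graph v → ℕ → Set
IsChromaticNumber F k = Colourable F k × (∀ j → Colourable F j → k ≤ j)

IsImage : (Fin a → Fin b) → Subset a → Subset b → Set
IsImage f p q = ∀ y → y ∈ q ⇔ (∃[ x ] (x ∈ p × f x ≡ y))

-- G is isomorphic to a (not necessarily induced) subhypergraph of H.
Contains : Hypergraph r b → Hypergraph r a → Set
Contains {b = b} {a = a} H G =
  Σ[ f ∈ (Fin a → Fin b) ]
    (Injective _≡_ _≡_ f ×
     (∀ {e} → e ∈ˡ edges G → ∃[ e′ ] (e′ ∈ˡ edges H × IsImage f e e′)))

-- m = ex_r(n, G).  There is no such m when every r-uniform hypergraph on n
-- vertices contains G, which happens only for edgeless G.
IsEx : (n : ℕ) → Hypergraph r a → ℕ → Set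
IsEx {r = r} n G m =
  (Σ[ H ∈ Hypergraph r n ] (¬ Contains H G × size H ≡ m)) ×
  (∀ (H : Hypergraph r n) → ¬ Contains H G → size H ≤ m)

-- For q > 0 this is the real inequality m ≤ C · n^(p/q), raised to the power q.
BoundedByPower : (m C n p q : ℕ) → Set
BoundedByPower m C n p q = m ^ q ≤ C ^ q * n ^ p

-- The i-th of m consecutive blocks of k vertices.
block : ∀ m k → Fin m → Subset (m * k)
block m k i = concat (replicate m ⊥ [ i ]≔ ⊤)

private
  ∣++∣ : (p : Subset a) (q : Subset b) → ∣ p ++ q ∣ ≡ ∣ p ∣ + ∣ q ∣
  ∣++∣ []            q = refl
  ∣++∣ (inside  ∷ p) q = cong suc (∣++∣ p q)
  ∣++∣ (outside ∷ p) q = ∣++∣ p q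

  ∣concat-⊥∣ : ∀ m k → ∣ concat (replicate m (⊥ {k})) ∣ ≡ 0
  ∣concat-⊥∣ zero    k = refl
  ∣concat-⊥∣ (suc m) k =
    trans (∣++∣ (⊥ {k}) _) (cong₂ _+_ (∣⊥∣≡0 k) (∣concat-⊥∣ m k))

  ∣block∣ : ∀ m k i → ∣ block m k i ∣ ≡ k
  ∣block∣ (suc m) k zero =
    trans (∣++∣ (⊤ {k}) _)
      (trans (cong₂ _+_ (∣⊤∣≡n k) (∣concat-⊥∣ m k)) (+-identityʳ k))
  ∣block∣ (suc m) k (suc i) =
    trans (∣++∣ (⊥ {k}) _) (cong₂ _+_ (∣⊥∣≡0 k) (∣block∣ m k i))

  lookup-injective : {xs : List A} → Unique xs →
                     ∀ {i j} → lookup xs i ≡ lookup xs j → i ≡ j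
  lookup-injective (_  ∷ _) {zero}  {zero}  _  = refl
  lookup-injective (px ∷ _) {zero}  {suc j} eq =
    contradiction eq (All.lookup px (∈-lookup j))
  lookup-injective (px ∷ _) {suc i} {zero}  eq =
    contradiction (sym eq) (All.lookup px (∈-lookup i))
  lookup-injective (_  ∷ u) {suc i} {suc j} eq = cong suc (lookup-injective u eq)

-- F⁺: the first v vertices are V(F), and they are followed by one block S_e of
-- r - 2 new vertices for each edge e of F.
expansion : 2 ≤ r → (F : Graph v) → Hypergraph r (v + size F * (r ∸ 2))
expansion {r = r} 2≤r F = record
  { edges   = tabulate edge
  ; unique  = Unique.tabulate⁺ λ {i} {j} eq →
      lookup-injective (unique F)
        (++-injectiveˡ (lookup (edges F) i) (lookup (edges F) j) eq)
  ; uniform = All.tabulate⁺ λ i →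
      trans (∣++∣ (lookup (edges F) i) _)
        (trans (cong₂ _+_ (All.lookup (uniform F) (∈-lookup i)) (∣block∣ (size F) (r ∸ 2) i))
          (m+[n∸m]≡n 2≤r))
  }
  where
  edge : Fin (size F) → Subset _
  edge i = lookup (edges F) i ++ block (size F) (r ∸ 2) i

{-# OPTIONS --safe #-}

-- F⁺ embeds into the complete r-partite hypergraph with x vertices in each part
-- (a box): an r-colouring of F distributes V(F) over the parts, and the r - 2
-- new vertices of an edge take the r - 2 colours missing on its ends. So it
-- suffices to bound the number of edges of a box-free hypergraph, following
-- Erdős: by the power mean inequality, it is controlled by the links
-- { v : (a_i , v) is an edge for all i } of the x-tuples a of vertices. A tuple
-- with distinct entries has a box-free link, which is small by induction on r,
-- and tuples with a repeated entry are rare.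
module Submission where

open import Defs
open import Data.Nat using (ℕ; _+_; _*_; _∸_; _^_; _≤_; _<_)
open import Data.Nat.Properties using (<⇒≤)
open import Data.Nat.Combinatorics using (_C_)
open import Data.Product using (∃-syntax; _×_)

open import Data.Bool using (true; false; if_then_else_)
open import Data.Fin as Fin
  using (Fin; zero; suc; _↑ˡ_; _↑ʳ_; combine; remQuot; inject≤; fromℕ<; splitAt; punchIn; punchOut)
open import Data.Fin.Properties as Fin
  using (inject≤-injective; injective⇒≤; any?; punchIn-punchOut; punchIn-injective)
open import Data.Fin.Subset using (Subset; inside; outside; ⊤; ⊥; ∣_∣) renaming (_∈_ to _∈ₛ_)
open import Data.Fin.Subset.Properties using (⊆-antisym)
open import Data.List as List
  using (List; []; _∷_; length; lookup; map; filter; allFin; cartesianProductWith)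
open import Data.List.Membership.Propositional using (_∈_)
open import Data.List.Membership.Propositional.Properties
  using (∈-allFin; ∈-cartesianProductWith⁺; ∈-filter⁺; ∈-filter⁻; ∈-lookup; ∈-tabulate⁻)
import Data.List.Membership.Setoid.Properties as Membership
open import Data.List.Properties using (length-tabulate)
import Data.List.Relation.Unary.All as Allˡ
open import Data.List.Relation.Unary.AllPairs using (_∷_)
open import Data.List.Relation.Unary.Any using (here)
open import Data.List.Relation.Unary.Unique.Propositional using (Unique)
open import Data.List.Relation.Unary.Unique.Propositional.Properties using (filter⁺; allFin⁺)
open import Data.Nat using (zero; suc; NonZero; z≤n; s≤s)
open import Data.Nat.Combinatorics using (nC1≡n; nCk+nC[k+1]≡[n+1]C[k+1])
open import Data.Nat.ListAction using (sum)
open import Data.Nat.Properties hiding (<⇒≤; _≟_; suc-injective)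
open import Data.Nat.Tactic.RingSolver using (solve-∀)
open import Data.Product using (Σ-syntax; _,_; proj₁; proj₂; uncurry)
open import Data.Product.Properties using (,-injective)
open import Data.Sum as Sum using (_⊎_; inj₁; inj₂)
open import Data.Sum.Properties using (inj₁-injective; inj₂-injective)
open import Data.Vec as Vec using (Vec; []; _∷_; here; there; tabulate; replicate; _[_]≔_; _++_)
open import Data.Vec.Functional using (insertAt; updateAt)
open import Data.Vec.Functional.Properties
  using (insertAt-lookup; insertAt-punchIn; updateAt-updates; updateAt-minimal)
open import Data.Vec.Membership.Propositional.Properties using () renaming (∈-lookup to ∈-lookupᵛ)
open import Data.Vec.Properties
  using (≡-dec; lookup∘tabulate; lookup-++ˡ; lookup-++ʳ; lookup-concat; lookup∘update; lookup∘update′;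
         lookup-replicate; []=⇒lookup; lookup⇒[]=)
open import Data.Vec.Relation.Unary.All as Allᵛ using (All; []; _∷_; all?)
import Data.Vec.Relation.Unary.All.Properties as Allᵛₚ
open import Data.Vec.Relation.Unary.AllPairs using (allPairs?)
open import Data.Vec.Relation.Unary.Unique.Propositional using () renaming (Unique to Uniqueᵛ)
import Data.Vec.Relation.Unary.Unique.Propositional.Properties as Uniqueᵛ
open import Function using (_∘_; it; const; _⇔_; mk⇔; Equivalence)
open import Function.Definitions using (Injective)
open import Level using (0ℓ)
open import Relation.Binary.PropositionalEquality
  using (_≡_; _≢_; refl; sym; trans; cong; cong₂; subst; subst₂; setoid; module ≡-Reasoning)
open import Relation.Nullary using (Dec; yes; no; does; ¬_; contradiction; _×-dec_)
open import Relation.Nullary.Decidable using (¬?)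
open import Relation.Unary using (Pred; Decidable)

open Equivalence

private
  variable
    A B : Set
    k m n r t v : ℕ

-- Finite sums and the power mean inequality

∑ : List A → (A → ℕ) → ℕ
∑ xs f = sum (map f xs)

∑-mono : ∀ xs {f g : A → ℕ} → (∀ x → f x ≤ g x) → ∑ xs f ≤ ∑ xs g
∑-mono []       f≤g = z≤n
∑-mono (x ∷ xs) f≤g = +-mono-≤ (f≤g x) (∑-mono xs f≤g)

∑-cong : ∀ xs {f g : A → ℕ} → (∀ x → f x ≡ g x) → ∑ xs f ≡ ∑ xs g
∑-cong []       f≡g = refl
∑-cong (x ∷ xs) f≡g = cong₂ _+_ (f≡g x) (∑-cong xs f≡g)

∑-const : ∀ (xs : List A) c → ∑ xs (λ _ → c) ≡ length xs * c
∑-const []       c = refl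
∑-const (x ∷ xs) c = cong (c +_) (∑-const xs c)

∑-+ : ∀ xs (f g : A → ℕ) → ∑ xs (λ x → f x + g x) ≡ ∑ xs f + ∑ xs g
∑-+ []       f g = refl
∑-+ (x ∷ xs) f g rewrite ∑-+ xs f g = interchange (f x) (g x) (∑ xs f) (∑ xs g)
  where
  interchange : ∀ a b c d → a + b + (c + d) ≡ a + c + (b + d)
  interchange = solve-∀

*-∑ : ∀ c xs (f : A → ℕ) → c * ∑ xs f ≡ ∑ xs (λ x → c * f x)
*-∑ c []       f = *-zeroʳ c
*-∑ c (x ∷ xs) f = trans (*-distribˡ-+ c (f x) _) (cong (c * f x +_) (*-∑ c xs f))

∑-* : ∀ xs (f : A → ℕ) c → ∑ xs f * c ≡ ∑ xs (λ x → f x * c)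
∑-* xs f c = trans (*-comm _ c) (trans (*-∑ c xs f) (∑-cong xs λ x → *-comm c (f x)))

∑-swap : ∀ xs ys (f : A → B → ℕ) →
         ∑ xs (λ x → ∑ ys (f x)) ≡ ∑ ys (λ y → ∑ xs (λ x → f x y))
∑-swap []       ys f = sym (trans (∑-const ys 0) (*-zeroʳ (length ys)))
∑-swap (x ∷ xs) ys f = trans (cong (∑ ys (f x) +_) (∑-swap xs ys f)) (sym (∑-+ ys (f x) _))

∑-++ : ∀ xs ys (f : A → ℕ) → ∑ (xs List.++ ys) f ≡ ∑ xs f + ∑ ys f
∑-++ []       ys f = refl
∑-++ (x ∷ xs) ys f = trans (cong (f x +_) (∑-++ xs ys f)) (sym (+-assoc (f x) _ _))

∑-map : ∀ (g : A → B) xs (f : B → ℕ) → ∑ (map g xs) f ≡ ∑ xs (f ∘ g)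
∑-map g []       f = refl
∑-map g (x ∷ xs) f = cong (f (g x) +_) (∑-map g xs f)

-- With `b = a + e` and `d = c + f` the two sides differ by `e * f`.
rearrangement : ∀ {a b c d} → a ≤ b → c ≤ d → a * d + b * c ≤ a * c + b * d
rearrangement {a} {c = c} a≤b c≤d
  with e , refl ← m≤n⇒∃[o]m+o≡n a≤b | f , refl ← m≤n⇒∃[o]m+o≡n c≤d =
  subst (a * (c + f) + (a + e) * c ≤_) (expand a e c f) (m≤m+n _ (e * f))
  where
  expand : ∀ a e c f → a * (c + f) + (a + e) * c + e * f ≡ a * c + (a + e) * (c + f)
  expand = solve-∀

rearrangement-^ : ∀ a b q → a * b ^ q + b * a ^ q ≤ a ^ suc q + b ^ suc q
rearrangement-^ a b q with ≤-total a b
... | inj₁ a≤b = rearrangement a≤b (^-monoˡ-≤ q a≤b)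
... | inj₂ b≤a = subst₂ _≤_ (+-comm (b * a ^ q) _) (+-comm (b ^ suc q) _)
                   (rearrangement b≤a (^-monoˡ-≤ q b≤a))

module _ (f : A → ℕ) (q : ℕ) where

  -- The sum of `rearrangement-^` over `xs` with `a` fixed. It handles the cross terms between a new
  -- head and the tail in `chebyshev`.
  rearrangement-∑ : ∀ a xs → a * ∑ xs (λ x → f x ^ q) + ∑ xs f * a ^ q
                             ≤ ∑ xs (λ x → f x ^ suc q) + length xs * a ^ suc q
  rearrangement-∑ a []       = ≤-reflexive (cong (_+ 0) (*-zeroʳ a))
  rearrangement-∑ a (x ∷ xs) = subst₂ _≤_
    (regroup₁ a (f x) (f x ^ q) (a ^ q) (∑ xs f) _)
    (regroup₂ (a ^ suc q) (f x ^ suc q) _ _)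
    (+-mono-≤ (rearrangement-^ a (f x) q) (rearrangement-∑ a xs))
    where
    regroup₁ : ∀ a b b^q a^q s s^q →
      a * b^q + b * a^q + (a * s^q + s * a^q) ≡ a * (b^q + s^q) + (b + s) * a^q
    regroup₁ = solve-∀
    regroup₂ : ∀ a b s l → a + b + (s + l) ≡ b + s + (a + l)
    regroup₂ = solve-∀

  -- The values of `f` and their `q`-th powers are similarly ordered, so this is an instance of
  -- Chebyshev's sum inequality.
  chebyshev : ∀ xs → ∑ xs f * ∑ xs (λ x → f x ^ q) ≤ length xs * ∑ xs (λ x → f x ^ suc q)
  chebyshev []       = z≤n
  chebyshev (x ∷ xs) = subst₂ _≤_
    (regroup₁ (f x) (f x ^ q) (∑ xs f) _)
    (regroup₂ (f x ^ suc q) (∑ xs (λ x → f x ^ suc q)) (length xs))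
    (+-monoʳ-≤ (f x ^ suc q) (+-mono-≤ (rearrangement-∑ (f x) xs) (chebyshev xs)))
    where
    regroup₁ : ∀ a a^q s s^q →
      a * a^q + ((a * s^q + s * a^q) + s * s^q) ≡ (a + s) * (a^q + s^q)
    regroup₁ = solve-∀
    regroup₂ : ∀ a s l → a + ((s + l * a) + l * s) ≡ (a + s) + l * (a + s)
    regroup₂ = solve-∀

-- Division-free form of `(s / l) ^ q ≤ (∑ f ^ q) / l` for length `l` and sum `s`. The induction is
-- on `q`, and `chebyshev` raises the exponent by one.
power-mean : ∀ (f : A → ℕ) q xs → length xs * ∑ xs f ^ q ≤ length xs ^ q * ∑ xs (λ x → f x ^ q)
power-mean f zero    xs = ≤-reflexive (trans (sym (∑-const xs 1)) (sym (*-identityˡ _)))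
power-mean f (suc q) xs = begin
  l * (s * s ^ q)                            ≡⟨ regroup₁ l s (s ^ q) ⟩
  s * (l * s ^ q)                            ≤⟨ *-monoʳ-≤ s (power-mean f q xs) ⟩
  s * (l ^ q * ∑ xs (λ x → f x ^ q))         ≡⟨ regroup₁ s (l ^ q) _ ⟩
  l ^ q * (s * ∑ xs (λ x → f x ^ q))         ≤⟨ *-monoʳ-≤ (l ^ q) (chebyshev f q xs) ⟩
  l ^ q * (l * ∑ xs (λ x → f x ^ suc q))     ≡⟨ regroup₂ (l ^ q) l _ ⟩
  l * l ^ q * ∑ xs (λ x → f x ^ suc q)       ∎
  where
  open ≤-Reasoning
  l = length xs
  s = ∑ xs f
  regroup₁ : ∀ a b c → a * (b * c) ≡ b * (a * c)
  regroup₁ = solve-∀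
  regroup₂ : ∀ a b c → a * (b * c) ≡ b * a * c
  regroup₂ = solve-∀

^-distribʳ-* : ∀ a b q → (a * b) ^ q ≡ a ^ q * b ^ q
^-distribʳ-* a b zero    = refl
^-distribʳ-* a b (suc q) = trans (cong (a * b *_) (^-distribʳ-* a b q)) (regroup a b (a ^ q) (b ^ q))
  where
  regroup : ∀ a b c d → a * b * (c * d) ≡ a * c * (b * d)
  regroup = solve-∀

-- Erdős's bound for hypergraphs without a complete r-partite subhypergraph

tuples : ∀ n k → List (Vec (Fin n) k)
tuples n zero    = [] ∷ []
tuples n (suc k) = cartesianProductWith _∷_ (allFin n) (tuples n k)

∈-tuples : (v : Vec (Fin n) k) → v ∈ tuples n k
∈-tuples []      = here refl
∈-tuples (x ∷ v) = ∈-cartesianProductWith⁺ _∷_ (∈-allFin x) (∈-tuples v)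

∑-tuples-suc : ∀ n k (f : Vec (Fin n) (suc k) → ℕ) →
               ∑ (tuples n (suc k)) f ≡ ∑ (allFin n) (λ i → ∑ (tuples n k) (λ v → f (i ∷ v)))
∑-tuples-suc n k f = go (allFin n)
  where
  go : ∀ is → ∑ (cartesianProductWith _∷_ is (tuples n k)) f
              ≡ ∑ is (λ i → ∑ (tuples n k) (λ v → f (i ∷ v)))
  go []       = refl
  go (i ∷ is) = trans (∑-++ (map (i ∷_) (tuples n k)) _ f)
                  (cong₂ _+_ (∑-map (i ∷_) (tuples n k) f) (go is))

∑-allFin-const : ∀ n c → ∑ (allFin n) (λ _ → c) ≡ n * c
∑-allFin-const n c = trans (∑-const (allFin n) c) (cong (_* c) (length-tabulate {n = n} (λ i → i)))

∑-tuples-const : ∀ n k c → ∑ (tuples n k) (λ _ → c) ≡ n ^ k * c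
∑-tuples-const n zero    c = refl
∑-tuples-const n (suc k) c = begin
  ∑ (tuples n (suc k)) (λ _ → c)                    ≡⟨ ∑-tuples-suc n k _ ⟩
  ∑ (allFin n) (λ _ → ∑ (tuples n k) (λ _ → c))     ≡⟨ ∑-allFin-const n _ ⟩
  n * ∑ (tuples n k) (λ _ → c)                      ≡⟨ cong (n *_) (∑-tuples-const n k c) ⟩
  n * (n ^ k * c)                                   ≡⟨ *-assoc n _ c ⟨
  n ^ suc k * c                                     ∎
  where open ≡-Reasoning

length-tuples : ∀ n k → length (tuples n k) ≡ n ^ k
length-tuples n k = begin
  length (tuples n k)              ≡⟨ *-identityʳ _ ⟨
  length (tuples n k) * 1          ≡⟨ ∑-const (tuples n k) 1 ⟨
  ∑ (tuples n k) (λ _ → 1)         ≡⟨ ∑-tuples-const n k 1 ⟩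
  n ^ k * 1                        ≡⟨ *-identityʳ _ ⟩
  n ^ k                            ∎
  where open ≡-Reasoning

-- Counting with Iverson brackets

[_] : Dec A → ℕ
[ d ] = if does d then 1 else 0

[]≤1 : (d : Dec A) → [ d ] ≤ 1
[]≤1 (yes _) = ≤-refl
[]≤1 (no _)  = z≤n

[]-× : (d : Dec A) (e : Dec B) → [ d ×-dec e ] ≡ [ d ] * [ e ]
[]-× (yes _) e = sym (*-identityˡ [ e ])
[]-× (no _)  e = refl

count : {P : Pred A 0ℓ} → Decidable P → List A → ℕ
count P? xs = ∑ xs (λ x → [ P? x ])

count-filter : {P : Pred A 0ℓ} (P? : Decidable P) → ∀ xs → count P? xs ≡ length (filter P? xs)
count-filter P? []       = refl
count-filter P? (x ∷ xs) with does (P? x)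
... | true  = cong suc (count-filter P? xs)
... | false = count-filter P? xs

-- Expanding the power of a sum of indicators gives one term per `t`-tuple. This turns `t`-th powers
-- of degrees into counts of `t`-tuples.
count-^ : {P : Pred (Fin n) 0ℓ} (P? : Decidable P) → ∀ t →
          count P? (allFin n) ^ t ≡ count (all? P?) (tuples n t)
count-^         P? zero    = refl
count-^ {n = n} P? (suc t) = begin
  s * s ^ t                                                    ≡⟨ cong (s *_) (count-^ P? t) ⟩
  s * count (all? P?) (tuples n t)                             ≡⟨ ∑-* (allFin n) _ _ ⟩
  ∑ (allFin n) (λ i → [ P? i ] * count (all? P?) (tuples n t)) ≡⟨ ∑-cong (allFin n) (λ i → *-∑ [ P? i ] (tuples n t) _) ⟩
  ∑ (allFin n) (λ i → ∑ (tuples n t) (λ v → [ P? i ] * [ all? P? v ]))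
    ≡⟨ ∑-cong (allFin n) (λ i → ∑-cong (tuples n t) (λ v → []-× (P? i) (all? P? v))) ⟨
  ∑ (allFin n) (λ i → ∑ (tuples n t) (λ v → [ all? P? (i ∷ v) ]))
    ≡⟨ ∑-tuples-suc n t _ ⟨
  count (all? P?) (tuples n (suc t))                           ∎
  where
  open ≡-Reasoning
  s = count P? (allFin n)

-- Tuples with a repeated entry

unique? : Decidable (Uniqueᵛ {A = Fin n} {n = t})
unique? = allPairs? (λ i j → ¬? (i Fin.≟ j))

count-≢ : ∀ {i : Fin n} {is} → Allˡ.All (i ≢_) is → count (Fin._≟ i) is ≡ 0
count-≢             Allˡ.[]                  = refl
count-≢ {i = i} (Allˡ._∷_ {x = j} i≢j i≢is) with j Fin.≟ i
... | yes j≡i = contradiction (sym j≡i) i≢j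
... | no  _   = count-≢ i≢is

count-≡ : ∀ (j : Fin n) {is} → Unique is → count (Fin._≟ j) is ≤ 1
count-≡ j {[]}     _          = z≤n
count-≡ j {i ∷ is} (i∉is ∷ u) with i Fin.≟ j
... | yes refl = ≤-reflexive (cong suc (count-≢ i∉is))
... | no  _    = count-≡ j u

multiplicity : Fin n → Vec (Fin n) t → ℕ
multiplicity i []      = 0
multiplicity i (j ∷ v) = [ i Fin.≟ j ] + multiplicity i v

-- A repetition in `i ∷ v` either involves the head, so that `i` occurs in `v`, or lies within `v`.
repeated-∷ : ∀ (i : Fin n) (v : Vec (Fin n) t) →
             [ ¬? (unique? (i ∷ v)) ] ≤ multiplicity i v + [ ¬? (unique? v) ]
repeated-∷ i v = split (all? (λ j → ¬? (i Fin.≟ j)) v) (unique? v) (occurs v)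
  where
  occurs : ∀ {t} (v : Vec (Fin _) t) → [ ¬? (all? (λ j → ¬? (i Fin.≟ j)) v) ] ≤ multiplicity i v
  occurs []      = z≤n
  occurs (j ∷ v) with i Fin.≟ j
  ... | yes _ = s≤s z≤n
  ... | no  _ = occurs v
  split : (d : Dec A) (e : Dec B) → ∀ {m} → [ ¬? d ] ≤ m → [ ¬? (d ×-dec e) ] ≤ m + [ ¬? e ]
  split (yes _) e {m} _   = m≤n+m _ m
  split (no _)  e     1≤m = ≤-trans 1≤m (m≤m+n _ _)

-- Each of the `t` positions contributes to only one `i`.
∑-multiplicity : ∀ (v : Vec (Fin n) t) → ∑ (allFin n) (λ i → multiplicity i v) ≤ t
∑-multiplicity {n = n} []      = ≤-reflexive (trans (∑-const (allFin n) 0) (*-zeroʳ (length (allFin n))))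
∑-multiplicity {n = n} (j ∷ v) = subst (_≤ _) (sym (∑-+ (allFin n) _ _))
  (+-mono-≤ (count-≡ j (allFin⁺ n)) (∑-multiplicity v))

-- For each tail at most `t` heads repeat one of its entries, so the number `D` of tuples with a
-- repetition satisfies `D (suc t) ≤ t * n ^ t + n * D t`. The factor `n` on the left replaces a
-- division by `n`.
count-repeated : ∀ n t → n * count (λ v → ¬? (unique? v)) (tuples n t) ≤ t ^ 2 * n ^ t
count-repeated n zero    = ≤-reflexive (*-zeroʳ n)
count-repeated n (suc t) = begin
  n * D (suc t)
    ≡⟨ cong (n *_) (∑-tuples-suc n t _) ⟩
  n * ∑ (allFin n) (λ i → ∑ (tuples n t) (λ v → [ ¬? (unique? (i ∷ v)) ]))
    ≤⟨ *-monoʳ-≤ n (∑-mono (allFin n) (λ i → ∑-mono (tuples n t) (repeated-∷ i))) ⟩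
  n * ∑ (allFin n) (λ i → ∑ (tuples n t) (λ v → multiplicity i v + [ ¬? (unique? v) ]))
    ≡⟨ cong (n *_) (∑-cong (allFin n) (λ i → ∑-+ (tuples n t) _ _)) ⟩
  n * ∑ (allFin n) (λ i → ∑ (tuples n t) (multiplicity i) + D t)
    ≡⟨ cong (n *_) (∑-+ (allFin n) _ _) ⟩
  n * (∑ (allFin n) (λ i → ∑ (tuples n t) (multiplicity i)) + ∑ (allFin n) (λ _ → D t))
    ≡⟨ cong (n *_) (cong₂ _+_ (∑-swap (allFin n) (tuples n t) multiplicity) (∑-allFin-const n (D t))) ⟩
  n * (∑ (tuples n t) (λ v → ∑ (allFin n) (λ i → multiplicity i v)) + n * D t)
    ≤⟨ *-monoʳ-≤ n (+-mono-≤ (∑-mono (tuples n t) ∑-multiplicity) (count-repeated n t)) ⟩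
  n * (∑ (tuples n t) (λ _ → t) + t ^ 2 * n ^ t)
    ≡⟨ cong (λ m → n * (m + t ^ 2 * n ^ t)) (∑-tuples-const n t t) ⟩
  n * (n ^ t * t + t ^ 2 * n ^ t)
    -- Slack that completes the square: `t + t ^ 2 + suc t` equals `suc t ^ 2`.
    ≤⟨ m≤m+n _ (suc t * (n * n ^ t)) ⟩
  n * (n ^ t * t + t ^ 2 * n ^ t) + suc t * (n * n ^ t)
    ≡⟨ regroup n t (n ^ t) ⟩
  suc t ^ 2 * n ^ suc t ∎
  where
  open ≤-Reasoning
  D = λ t → count (λ v → ¬? (unique? v)) (tuples n t)
  regroup : ∀ n t m → n * (m * t + (t * (t * 1)) * m) + (1 + t) * (n * m) ≡ ((1 + t) * ((1 + t) * 1)) * (n * m)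
  regroup = solve-∀

-- The recursion makes the remaining parts a box in the common link of the first part, which is the
-- form that the induction on the arity uses. Disjointness of the parts is derived in `box⇒grid` for
-- the tuples of a hypergraph.
Box : ∀ t k → Pred (Vec (Fin n) k) 0ℓ → Set
Box         t zero    P = P []
Box {n = n} t (suc k) P = Σ[ a ∈ Vec (Fin n) t ] (Uniqueᵛ a × Box t k (λ v → All (λ i → P (i ∷ v)) a))

lookup-injective : {xs : List A} → Unique xs → ∀ {i j} → lookup xs i ≡ lookup xs j → i ≡ j
lookup-injective (_  ∷ _) {zero}  {zero}  _  = refl
lookup-injective (px ∷ _) {zero}  {suc j} eq = contradiction eq (Allˡ.lookup px (∈-lookup j))
lookup-injective (px ∷ _) {suc i} {zero}  eq = contradiction (sym eq) (Allˡ.lookup px (∈-lookup i))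
lookup-injective (_  ∷ u) {suc i} {suc j} eq = cong suc (lookup-injective u eq)

-- Any `t` distinct indices that satisfy `P` form a box; the witness takes the first `t` of the
-- filtered list.
count-box₁ : ∀ t {P : Pred (Vec (Fin n) 1) 0ℓ} (P? : Decidable P) →
             ¬ Box t 1 P → count (λ i → P? (i ∷ [])) (allFin n) ≤ t
count-box₁ {n = n} t {P} P? ¬box = ≮⇒≥ λ t<c → ¬box (box (subst (t ≤_) (count-filter Q? (allFin n)) (<⇒≤ t<c)))
  where
  Q? : Decidable (λ i → P (i ∷ []))
  Q? i = P? (i ∷ [])
  is = filter Q? (allFin n)
  box : t ≤ length is → Box t 1 P
  box t≤ = tabulate (λ s → lookup is (inject≤ s t≤))
         , Uniqueᵛ.tabulate⁺ (λ eq → inject≤-injective t≤ t≤ _ _ (lookup-injective (filter⁺ Q? (allFin⁺ n)) eq))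
         , Allᵛₚ.tabulate⁺ (λ s → proj₂ (∈-filter⁻ Q? {xs = allFin n} (∈-lookup (inject≤ s t≤))))

-- The arithmetic of the induction step. N is the number of edges, M and T count
-- the (r-1)-tuples and t-tuples of vertices, W and Z are the first and q-th
-- moment of the number of edges in the links of the t-tuples.
combine-moments : ∀ {n N W Z K} M T t q .{{_ : NonZero M}} .{{_ : NonZero T}} →
                  M * N ^ t ≤ M ^ t * W → T * W ^ q ≤ T ^ q * Z → n * Z ≤ K * (T * M ^ q) →
                  n * N ^ (t * q) ≤ K * (M ^ (t * q) * T ^ q)
combine-moments {n} {N} {W} {Z} {K} M T t q h₁ h₂ h₃ =
  -- Each hypothesis is used once, `h₁` after raising it to the power `q`; this leaves the factor
  -- `T * M ^ q` on both sides.
  *-cancelˡ-≤ (T * M ^ q) {{m*n≢0 T (M ^ q) {{it}} {{m^n≢0 M q}}}} (begin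
  T * M ^ q * (n * N ^ (t * q))              ≡⟨ cong (λ m → T * M ^ q * (n * m)) (^-*-assoc N t q) ⟨
  T * M ^ q * (n * (N ^ t) ^ q)              ≡⟨ regroup₁ T (M ^ q) n _ ⟩
  n * T * (M ^ q * (N ^ t) ^ q)              ≡⟨ cong (n * T *_) (^-distribʳ-* M (N ^ t) q) ⟨
  n * T * (M * N ^ t) ^ q                    ≤⟨ *-monoʳ-≤ (n * T) (^-monoˡ-≤ q h₁) ⟩
  n * T * (M ^ t * W) ^ q                    ≡⟨ cong (n * T *_) (^-distribʳ-* (M ^ t) W q) ⟩
  n * T * ((M ^ t) ^ q * W ^ q)              ≡⟨ regroup₂ n T _ (W ^ q) ⟩
  n * (M ^ t) ^ q * (T * W ^ q)              ≤⟨ *-monoʳ-≤ (n * (M ^ t) ^ q) h₂ ⟩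
  n * (M ^ t) ^ q * (T ^ q * Z)              ≡⟨ regroup₃ n _ (T ^ q) Z ⟩
  (M ^ t) ^ q * T ^ q * (n * Z)              ≤⟨ *-monoʳ-≤ ((M ^ t) ^ q * T ^ q) h₃ ⟩
  (M ^ t) ^ q * T ^ q * (K * (T * M ^ q))    ≡⟨ cong (λ m → m * T ^ q * (K * (T * M ^ q))) (^-*-assoc M t q) ⟩
  M ^ (t * q) * T ^ q * (K * (T * M ^ q))    ≡⟨ regroup₄ (M ^ (t * q) * T ^ q) K _ ⟩
  T * M ^ q * (K * (M ^ (t * q) * T ^ q))    ∎)
  where
  open ≤-Reasoning
  regroup₁ : ∀ a b c d → a * b * (c * d) ≡ c * a * (b * d)
  regroup₁ = solve-∀
  regroup₂ : ∀ a b c d → a * b * (c * d) ≡ a * c * (b * d)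
  regroup₂ = solve-∀
  regroup₃ : ∀ a b c d → a * b * (c * d) ≡ b * c * (a * d)
  regroup₃ = solve-∀
  regroup₄ : ∀ a b c → a * (b * c) ≡ c * (b * a)
  regroup₄ = solve-∀

-- In closed form `t + k * t ^ 2`: the base case gives `t`, and each induction step adds `t ^ 2` for
-- the tuples with a repeated entry.
boxConstant : ℕ → ℕ → ℕ
boxConstant t zero    = t
boxConstant t (suc k) = t ^ 2 + boxConstant t k

-- Erdős's bound `N ≤ (K / n) ^ (1 / t ^ k) * n ^ suc k`, cleared of roots and division. The
-- induction step applies the power mean inequality to the degrees and then to the link sizes, and
-- the induction hypothesis to the links.
count-box : ∀ n .{{_ : NonZero n}} t k {P : Pred (Vec (Fin n) (suc k)) 0ℓ} (P? : Decidable P) →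
            ¬ Box t (suc k) P →
            n * count P? (tuples n (suc k)) ^ (t ^ k) ≤ boxConstant t k * (n ^ suc k) ^ (t ^ k)
count-box n t zero {P} P? ¬box = begin
  n * count P? (tuples n 1) ^ 1
    ≡⟨ cong (n *_) (^-identityʳ _) ⟩
  n * count P? (tuples n 1)
    ≡⟨ cong (n *_) (∑-tuples-suc n 0 _) ⟩
  n * ∑ (allFin n) (λ i → [ P? (i ∷ []) ] + 0)
    ≡⟨ cong (n *_) (∑-cong (allFin n) (λ i → +-identityʳ _)) ⟩
  n * count (λ i → P? (i ∷ [])) (allFin n)
    ≤⟨ *-monoʳ-≤ n (count-box₁ t P? ¬box) ⟩
  n * t
    ≡⟨ *-comm n t ⟩
  t * n
    ≡⟨ cong (t *_) (trans (^-identityʳ (n ^ 1)) (^-identityʳ n)) ⟨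
  t * (n ^ 1) ^ 1 ∎
  where open ≤-Reasoning
count-box n t (suc k) {P} P? ¬box = begin
  n * N ^ (t * q)                          ≤⟨ combine-moments {n} {K = K} M T t q {{m^n≢0 n (suc k)}} {{m^n≢0 n t}} h₁ h₂ h₃ ⟩
  K * (M ^ (t * q) * T ^ q)                ≡⟨ cong (λ m → K * (M ^ (t * q) * m)) (^-*-assoc n t q) ⟩
  K * (M ^ (t * q) * n ^ (t * q))          ≡⟨ cong (K *_) (*-comm (M ^ (t * q)) _) ⟩
  K * (n ^ (t * q) * M ^ (t * q))          ≡⟨ cong (K *_) (^-distribʳ-* n M (t * q)) ⟨
  K * (n * M) ^ (t * q)                    ∎
  where
  open ≤-Reasoning
  -- The exponent that the induction hypothesis gives for links; the goal has exponent `t * q`.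
  q = t ^ k
  K = boxConstant t (suc k)
  M = n ^ suc k
  T = n ^ t
  N = count P? (tuples n (suc (suc k)))

  link : ∀ (a : Vec (Fin n) t) → Decidable (λ v → All (λ i → P (i ∷ v)) a)
  link a v = all? (λ i → P? (i ∷ v)) a

  degree : Vec (Fin n) (suc k) → ℕ
  degree v = count (λ i → P? (i ∷ v)) (allFin n)

  linkSize : Vec (Fin n) t → ℕ
  linkSize a = count (link a) (tuples n (suc k))

  W = ∑ (tuples n t) linkSize
  Z = ∑ (tuples n t) (λ a → linkSize a ^ q)

  N≡ : N ≡ ∑ (tuples n (suc k)) degree
  N≡ = trans (∑-tuples-suc n (suc k) _) (∑-swap (allFin n) (tuples n (suc k)) _)

  -- Double counting of the pairs of a tail `v` and a `t`-tuple `a` all of whose entries extend `v`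
  -- to a tuple in `P`.
  W≡ : ∑ (tuples n (suc k)) (λ v → degree v ^ t) ≡ W
  W≡ = trans (∑-cong (tuples n (suc k)) (λ v → count-^ (λ i → P? (i ∷ v)) t))
             (∑-swap (tuples n (suc k)) (tuples n t) _)

  h₁ : M * N ^ t ≤ M ^ t * W
  h₁ = subst₂ _≤_
    (cong₂ (λ l s → l * s ^ t) (length-tuples n (suc k)) (sym N≡))
    (cong₂ (λ l s → l ^ t * s) (length-tuples n (suc k)) W≡)
    (power-mean degree t (tuples n (suc k)))

  h₂ : T * W ^ q ≤ T ^ q * Z
  h₂ = subst (λ l → l * W ^ q ≤ l ^ q * Z) (length-tuples n t) (power-mean linkSize q (tuples n t))

  linkSize≤M : ∀ a → linkSize a ≤ M
  linkSize≤M a = begin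
    linkSize a                      ≤⟨ ∑-mono (tuples n (suc k)) (λ v → []≤1 (link a v)) ⟩
    ∑ (tuples n (suc k)) (λ _ → 1)  ≡⟨ ∑-tuples-const n (suc k) 1 ⟩
    M * 1                           ≡⟨ *-identityʳ M ⟩
    M                               ∎

  -- A box in the link of a duplicate-free `a` would extend by `a` to a box for `P`, so the
  -- induction hypothesis applies. For other `a` the indicator term pays for the trivial bound `M`.
  linkSize-bound : ∀ a → n * linkSize a ^ q ≤ (n * [ ¬? (unique? a) ] + boxConstant t k) * M ^ q
  linkSize-bound a with unique? a
  ... | yes u = subst (λ m → n * linkSize a ^ q ≤ (m + boxConstant t k) * M ^ q) (sym (*-zeroʳ n))
                  (count-box n t k (link a) (λ b → ¬box (a , u , b)))
  ... | no  _ = *-mono-≤ (≤-trans (≤-reflexive (sym (*-identityʳ n))) (m≤m+n _ _))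
                         (^-monoˡ-≤ q (linkSize≤M a))

  h₃ : n * Z ≤ K * (T * M ^ q)
  h₃ = begin
    n * Z
      ≡⟨ *-∑ n (tuples n t) _ ⟩
    ∑ (tuples n t) (λ a → n * linkSize a ^ q)
      ≤⟨ ∑-mono (tuples n t) linkSize-bound ⟩
    ∑ (tuples n t) (λ a → (n * [ ¬? (unique? a) ] + boxConstant t k) * M ^ q)
      ≡⟨ ∑-* (tuples n t) _ (M ^ q) ⟨
    ∑ (tuples n t) (λ a → n * [ ¬? (unique? a) ] + boxConstant t k) * M ^ q
      ≡⟨ cong (_* M ^ q) (∑-+ (tuples n t) _ _) ⟩
    (∑ (tuples n t) (λ a → n * [ ¬? (unique? a) ]) + ∑ (tuples n t) (λ _ → boxConstant t k)) * M ^ q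
      ≡⟨ cong (_* M ^ q) (cong₂ _+_ (sym (*-∑ n (tuples n t) _)) (∑-tuples-const n t (boxConstant t k))) ⟩
    (n * count (λ a → ¬? (unique? a)) (tuples n t) + T * boxConstant t k) * M ^ q
      ≤⟨ *-monoˡ-≤ (M ^ q) (+-monoˡ-≤ (T * boxConstant t k) (count-repeated n t)) ⟩
    (t ^ 2 * T + T * boxConstant t k) * M ^ q
      ≡⟨ regroup (t ^ 2) T (boxConstant t k) (M ^ q) ⟩
    K * (T * M ^ q) ∎
    where
    regroup : ∀ a b c d → (a * b + b * c) * d ≡ (a + c) * (b * d)
    regroup = solve-∀

-- Hypergraphs as sets of tuples

Enumeration : Subset n → ℕ → Set
Enumeration {n} e k =
  Σ[ f ∈ (Fin k → Fin n) ] (Injective _≡_ _≡_ f × (∀ y → y ∈ₛ e ⇔ (∃[ i ] f i ≡ y)))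

enumerate : (e : Subset n) → Enumeration e ∣ e ∣
enumerate []            = (λ ()) , (λ {i} → λ { {()} }) , λ ()
enumerate (outside ∷ e) with f , inj , mem ← enumerate e =
  suc ∘ f , inj ∘ Fin.suc-injective , λ where
    zero    → mk⇔ (λ ()) (λ ())
    (suc y) → mk⇔ (λ { (there y∈e) → let i , eq = to (mem y) y∈e in i , cong suc eq })
                  (λ (i , eq) → there (from (mem y) (i , Fin.suc-injective eq)))
enumerate {suc n} (inside ∷ e) with f , inj , mem ← enumerate e = g , g-inj , g-mem
  where
  g : Fin (suc ∣ e ∣) → Fin (suc n)
  g zero    = zero
  g (suc i) = suc (f i)
  g-inj : Injective _≡_ _≡_ g
  g-inj {zero}  {zero}  _  = refl
  g-inj {suc i} {suc j} eq = cong suc (inj (Fin.suc-injective eq))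
  g-mem : ∀ y → y ∈ₛ (inside ∷ e) ⇔ (∃[ i ] g i ≡ y)
  g-mem zero    = mk⇔ (λ _ → zero , refl) (λ _ → here)
  g-mem (suc y) = mk⇔ (λ { (there y∈e) → let i , eq = to (mem y) y∈e in suc i , cong suc eq })
                      (λ { (suc i , eq) → there (from (mem y) (i , Fin.suc-injective eq)) })

abstract
  -- Opaque, since the proofs rely on the specification in `Enumeration` and not on the order
  -- chosen.
  enumerateEdge : (H : Hypergraph r n) (j : Fin (size H)) → Enumeration (lookup (edges H) j) r
  enumerateEdge H j = subst (Enumeration _) (Allˡ.lookup (uniform H) (∈-lookup j)) (enumerate _)

tuple : (H : Hypergraph r n) → Fin (size H) → Vec (Fin n) r
tuple H j = tabulate (proj₁ (enumerateEdge H j))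

-- Each edge is represented by one ordering of its vertices, so that counting tuples bounds the
-- number of edges without a factor `r !`.
IsTuple : Hypergraph r n → Pred (Vec (Fin n) r) 0ℓ
IsTuple H w = ∃[ j ] tuple H j ≡ w

isTuple? : (H : Hypergraph r n) → Decidable (IsTuple H)
isTuple? H w = any? (λ j → ≡-dec Fin._≟_ (tuple H j) w)

-- The entries of a tuple determine its edge as a set, and the list of edges has no duplicates.
tuple-injective : (H : Hypergraph r n) → Injective _≡_ _≡_ (tuple H)
tuple-injective H {i} {j} eq =
  lookup-injective (unique H) (⊆-antisym (⊆-of i j eq) (⊆-of j i (sym eq)))
  where
  ⊆-of : ∀ i j → tuple H i ≡ tuple H j → ∀ {y} → y ∈ₛ lookup (edges H) i → y ∈ₛ lookup (edges H) j
  ⊆-of i j eq {y} y∈ with f , _ , f-mem ← enumerateEdge H i | g , _ , g-mem ← enumerateEdge H j =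
    let s , fs≡y = to (f-mem y) y∈ in
    from (g-mem y) (s , trans (sym (lookup∘tabulate g s))
      (trans (cong (λ w → Vec.lookup w s) (sym eq)) (trans (lookup∘tabulate f s) fs≡y)))

-- The position of `tuple H j` in the filtered list of tuples is injective in `j`.
size≤count : (H : Hypergraph r n) → size H ≤ count (isTuple? H) (tuples n r)
size≤count {r} {n} H = subst (size H ≤_) (sym (count-filter (isTuple? H) (tuples n r)))
  (injective⇒≤ λ {i} {j} eq → tuple-injective H (Membership.index-injective (setoid _) (member i) (member j) eq))
  where
  member : ∀ j → _
  member j = ∈-filter⁺ (isTuple? H) (∈-tuples (tuple H j)) (j , refl)

-- A complete r-partite subhypergraph: S labels the vertices within each part.
Grid : Hypergraph r n → Set → Set
Grid {r} {n} H S =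
  Σ[ g ∈ (Fin r → S → Fin n) ]
    ((∀ {i j s s′} → g i s ≡ g j s′ → i ≡ j × s ≡ s′) ×
     (∀ (σ : Fin r → S) → ∃[ j ] (∀ y → y ∈ₛ lookup (edges H) j ⇔ (∃[ i ] g i (σ i) ≡ y))))

Grid-↣ : ∀ {S S′} {H : Hypergraph r n} (h : S′ → S) → Injective _≡_ _≡_ h → Grid H S → Grid H S′
Grid-↣ h h-inj (g , g-inj , g-edge) =
  (λ i → g i ∘ h) , (λ eq → proj₁ (g-inj eq) , h-inj (proj₂ (g-inj eq))) , (λ σ → g-edge (h ∘ σ))

box-parts : ∀ t r {P : Pred (Vec (Fin n) r) 0ℓ} → Box t r P →
            Σ[ g ∈ (Fin r → Fin t → Fin n) ]
              ((∀ i → Injective _≡_ _≡_ (g i)) × (∀ (σ : Fin r → Fin t) → P (tabulate λ i → g i (σ i))))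
box-parts t zero    p           = (λ ()) , (λ ()) , λ _ → p
box-parts {n} t (suc r) (a , u , b) with g , g-inj , g-all ← box-parts t r b = g′ , g′-inj , λ σ →
  Allᵛ.lookup (g-all (σ ∘ suc)) (∈-lookupᵛ (σ zero) a)
  where
  g′ : Fin (suc r) → Fin t → Fin n
  g′ zero    = Vec.lookup a
  g′ (suc i) = g i
  g′-inj : ∀ i → Injective _≡_ _≡_ (g′ i)
  g′-inj zero    = Uniqueᵛ.lookup-injective u _ _
  g′-inj (suc i) = g-inj i

box⇒grid : (H : Hypergraph r n) → Box t r (IsTuple H) → Grid H (Fin t)
box⇒grid {r} {n} {t} H b with g , g-inj , g-tuple ← box-parts t r b = g , inj , edge
  where
  entry : ∀ (σ : Fin r → Fin t) i → proj₁ (enumerateEdge H (proj₁ (g-tuple σ))) i ≡ g i (σ i)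
  entry σ i with j , eq ← g-tuple σ =
    trans (sym (lookup∘tabulate _ i)) (trans (cong (λ w → Vec.lookup w i) eq) (lookup∘tabulate _ i))

  edge : ∀ (σ : Fin r → Fin t) → ∃[ j ] (∀ y → y ∈ₛ lookup (edges H) j ⇔ (∃[ i ] g i (σ i) ≡ y))
  edge σ = j , λ y → mk⇔
    (λ y∈ → let i , eq = to (mem y) y∈ in i , trans (sym (entry σ i)) eq)
    (λ (i , eq) → from (mem y) (i , trans (entry σ i) eq))
    where
    j = proj₁ (g-tuple σ)
    mem = proj₂ (proj₂ (enumerateEdge H j))

  transversal-injective : ∀ (σ : Fin r → Fin t) {i j} → g i (σ i) ≡ g j (σ j) → i ≡ j
  transversal-injective σ {i} {j} eq =
    proj₁ (proj₂ (enumerateEdge H (proj₁ (g-tuple σ)))) (trans (entry σ i) (trans eq (sym (entry σ j))))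

  -- Two vertices in different parts lie in a common edge, so they are distinct.
  inj : ∀ {i j s s′} → g i s ≡ g j s′ → i ≡ j × s ≡ s′
  inj {i} {j} {s} {s′} eq with i Fin.≟ j
  ... | yes refl = refl , g-inj i eq
  ... | no  i≢j  = contradiction
    (transversal-injective σ (trans (cong (g i) σi≡s) (trans eq (cong (g j) (sym σj≡s′))))) i≢j
    where
    -- The transversal through `s` in part `i` and `s′` in every other part, in particular in part
    -- `j`.
    σ : Fin r → Fin t
    σ = updateAt (const s′) i (const s)
    σi≡s = updateAt-updates i (const s′)
    σj≡s′ = updateAt-minimal j i (const s′) (i≢j ∘ sym)

-- The embedding of F⁺

-- Labels for the vertices of F⁺ within a colour class: vertices of F keep their
-- name, and the new vertices of an edge are labelled by the ends of that edge.
Label : ℕ → Set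
Label v = Fin v ⊎ (Fin v × Fin v)

-- This accounts for both summands of `x`: pairs go into the first `c` indices, where the theorem
-- takes `c` to be `(r C 2) * v ^ 2`, and vertices of F go into the last `v`.
label-index : ∀ c → v * v ≤ c → Label v → Fin (c + v)
label-index {v} c v*v≤c (inj₁ u)       = c ↑ʳ u
label-index {v} c v*v≤c (inj₂ (x , y)) = inject≤ (combine x y) v*v≤c ↑ˡ v

label-index-injective : ∀ c (v*v≤c : v * v ≤ c) → Injective _≡_ _≡_ (label-index c v*v≤c)
label-index-injective {v} c v*v≤c {inj₁ u} {inj₁ u′} eq = cong inj₁ (Fin.↑ʳ-injective c u u′ eq)
label-index-injective {v} c v*v≤c {inj₂ (x , y)} {inj₂ (x′ , y′)} eq = cong inj₂ (uncurry (cong₂ _,_)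
  (Fin.combine-injective x y x′ y′ (inject≤-injective v*v≤c v*v≤c _ _ (Fin.↑ˡ-injective v _ _ eq))))
label-index-injective {v} c v*v≤c {inj₁ u} {inj₂ w} eq
  with () ← trans (sym (Fin.splitAt-↑ʳ c v u)) (trans (cong (splitAt c) eq) (Fin.splitAt-↑ˡ c _ v))
label-index-injective {v} c v*v≤c {inj₂ w} {inj₁ u} eq
  with () ← trans (sym (Fin.splitAt-↑ˡ c _ v)) (trans (cong (splitAt c) eq) (Fin.splitAt-↑ʳ c v u))

-- Vertices and edges of the expansion

∈-block⁺ : ∀ (j : Fin m) (s : Fin k) → combine j s ∈ₛ block m k j
∈-block⁺ {m} {k} j s = lookup⇒[]= _ _ (begin
  Vec.lookup (block m k j) (combine j s)
    ≡⟨ lookup-concat (replicate m ⊥ [ j ]≔ ⊤) j s ⟩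
  Vec.lookup (Vec.lookup (replicate m ⊥ [ j ]≔ ⊤) j) s
    ≡⟨ cong (λ p → Vec.lookup p s) (lookup∘update j (replicate m ⊥) ⊤) ⟩
  Vec.lookup ⊤ s
    ≡⟨ lookup-replicate s inside ⟩
  inside ∎)
  where open ≡-Reasoning

∈-block⁻ : ∀ (j i : Fin m) (s : Fin k) → combine i s ∈ₛ block m k j → i ≡ j
∈-block⁻ {m} {k} j i s ∈b with i Fin.≟ j
... | yes i≡j = i≡j
... | no  i≢j = contradiction (trans (sym outside-block) ([]=⇒lookup ∈b)) λ ()
  where
  open ≡-Reasoning
  outside-block : Vec.lookup (block m k j) (combine i s) ≡ outside
  outside-block = begin
    Vec.lookup (block m k j) (combine i s)
      ≡⟨ lookup-concat (replicate m ⊥ [ j ]≔ ⊤) i s ⟩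
    Vec.lookup (Vec.lookup (replicate m ⊥ [ j ]≔ ⊤) i) s
      ≡⟨ cong (λ p → Vec.lookup p s) (lookup∘update′ i≢j (replicate m ⊥) ⊤) ⟩
    Vec.lookup (Vec.lookup (replicate m ⊥) i) s
      ≡⟨ cong (λ p → Vec.lookup p s) (lookup-replicate i ⊥) ⟩
    Vec.lookup (⊥ {k}) s
      ≡⟨ lookup-replicate s outside ⟩
    outside ∎

module Vertices (v m k : ℕ) where

  vertex : Fin v ⊎ (Fin m × Fin k) → Fin (v + m * k)
  vertex (inj₁ u)       = u ↑ˡ (m * k)
  vertex (inj₂ (j , s)) = v ↑ʳ combine j s

  -- The inverse of `vertex`; it allows maps out of F⁺ to be defined by cases on old and new
  -- vertices.
  name : Fin (v + m * k) → Fin v ⊎ (Fin m × Fin k)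
  name z = Sum.map₂ (remQuot k) (splitAt v z)

  name-vertex : (w : Fin v ⊎ (Fin m × Fin k)) → name (vertex w) ≡ w
  name-vertex (inj₁ u)       = cong (Sum.map₂ (remQuot k)) (Fin.splitAt-↑ˡ v u (m * k))
  name-vertex (inj₂ (j , s)) = trans
    (cong (Sum.map₂ (remQuot k)) (Fin.splitAt-↑ʳ v (m * k) (combine j s)))
    (cong inj₂ (Fin.remQuot-combine j s))

  vertex-name : (z : Fin (v + m * k)) → vertex (name z) ≡ z
  vertex-name z with splitAt v z in eq
  ... | inj₁ u = Fin.splitAt⁻¹-↑ˡ eq
  ... | inj₂ w = trans (cong (v ↑ʳ_) (Fin.combine-remQuot {m} k w)) (Fin.splitAt⁻¹-↑ʳ eq)

  name-injective : Injective _≡_ _≡_ name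
  name-injective {x = z} {y = z′} eq = trans (sym (vertex-name z)) (trans (cong vertex eq) (vertex-name z′))

  module _ (e : Subset v) (j : Fin m) where

    ∈-old⁺ : ∀ {u} → u ∈ₛ e → vertex (inj₁ u) ∈ₛ (e ++ block m k j)
    ∈-old⁺ {u} u∈e = lookup⇒[]= _ _ (trans (lookup-++ˡ e _ u) ([]=⇒lookup u∈e))

    ∈-old⁻ : ∀ {u} → vertex (inj₁ u) ∈ₛ (e ++ block m k j) → u ∈ₛ e
    ∈-old⁻ {u} ∈e = lookup⇒[]= _ _ (trans (sym (lookup-++ˡ e _ u)) ([]=⇒lookup ∈e))

    ∈-new⁺ : ∀ s → vertex (inj₂ (j , s)) ∈ₛ (e ++ block m k j)
    ∈-new⁺ s = lookup⇒[]= _ _ (trans (lookup-++ʳ e _ (combine j s)) ([]=⇒lookup (∈-block⁺ j s)))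

    ∈-new⁻ : ∀ {i s} → vertex (inj₂ (i , s)) ∈ₛ (e ++ block m k j) → i ≡ j
    ∈-new⁻ {i} {s} ∈e = ∈-block⁻ j i s (lookup⇒[]= _ _ (trans (sym (lookup-++ʳ e _ (combine i s))) ([]=⇒lookup ∈e)))

-- Colours other than two given ones

module _ {a b : Fin (2 + k)} (a≢b : a ≢ b) where

  -- `punchOut a≢b` is the position of `b` among the colours other than `a`, so the two `punchIn`s
  -- skip exactly `a` and `b`.
  other : Fin k → Fin (2 + k)
  other s = punchIn a (punchIn (punchOut a≢b) s)

  other-injective : Injective _≡_ _≡_ other
  other-injective eq = punchIn-injective (punchOut a≢b) _ _ (punchIn-injective a _ _ eq)

  data ColourView : Fin (2 + k) → Set where
    first     : ColourView a
    second    : ColourView b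
    remaining : ∀ s → ColourView (other s)

  colourView : ∀ i → ColourView i
  colourView i with a Fin.≟ i
  ... | yes refl = first
  ... | no  a≢i with punchOut a≢b Fin.≟ punchOut a≢i
  ...   | yes eq = subst ColourView (Fin.punchOut-injective a≢b a≢i eq) second
  ...   | no  b≢i = subst ColourView
    (trans (cong (punchIn a) (punchIn-punchOut b≢i)) (punchIn-punchOut a≢i)) (remaining (punchOut b≢i))

  module _ {S : Set} (p q o : S) where

    private
      tail : Fin (suc k) → S
      tail = insertAt (const o) (punchOut a≢b) q

    choose : Fin (2 + k) → S
    choose = insertAt tail a p

    choose-first : choose a ≡ p
    choose-first = insertAt-lookup tail a p

    choose-second : choose b ≡ q
    choose-second = begin
      choose b                            ≡⟨ cong choose (punchIn-punchOut a≢b) ⟨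
      choose (punchIn a (punchOut a≢b))   ≡⟨ insertAt-punchIn tail a p (punchOut a≢b) ⟩
      tail (punchOut a≢b)                 ≡⟨ insertAt-lookup (const o) (punchOut a≢b) q ⟩
      q                                   ∎
      where open ≡-Reasoning

    choose-remaining : ∀ s → choose (other s) ≡ o
    choose-remaining s = trans
      (insertAt-punchIn tail a p (punchIn (punchOut a≢b) s))
      (insertAt-punchIn (const o) (punchOut a≢b) q s)

module Embedding {v k n : ℕ} (2≤r : 2 ≤ 2 + k) (F : Graph v) (H : Hypergraph (2 + k) n)
  (colouring : Colourable F (2 + k)) (grid : Grid H (Label v)) where

  private
    c = proj₁ colouring
    g = proj₁ grid

  open Vertices v (size F) k

  end : Fin (size F) → Fin 2 → Fin v
  end j = proj₁ (enumerateEdge F j)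

  end-∈ : ∀ j i → end j i ∈ₛ lookup (edges F) j
  end-∈ j i = from (proj₂ (proj₂ (enumerateEdge F j)) _) (i , refl)

  x y : Fin (size F) → Fin v
  x j = end j zero
  y j = end j (suc zero)

  cx≢cy : ∀ j → c (x j) ≢ c (y j)
  cx≢cy j = proj₂ colouring (∈-lookup j) (end-∈ j zero) (end-∈ j (suc zero))
    λ eq → contradiction (proj₁ (proj₂ (enumerateEdge F j)) eq) λ ()

  ends-injective : ∀ {i j} → x i ≡ x j → y i ≡ y j → i ≡ j
  ends-injective {i} {j} eqx eqy = tuple-injective F (cong₂ (λ a b → a ∷ b ∷ []) eqx eqy)

  colour : Fin v ⊎ (Fin (size F) × Fin k) → Fin (2 + k)
  colour (inj₁ u)       = c u
  colour (inj₂ (j , s)) = other (cx≢cy j) s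

  label : Fin v ⊎ (Fin (size F) × Fin k) → Label v
  label (inj₁ u)       = inj₁ u
  label (inj₂ (j , s)) = inj₂ (x j , y j)

  -- Vertices of F are separated by their labels. New vertices of one edge share a label but differ
  -- in colour, and those of different edges differ in label because the ends determine the edge.
  colour-label-injective : ∀ {w w′} → colour w ≡ colour w′ → label w ≡ label w′ → w ≡ w′
  colour-label-injective {inj₁ _} {inj₁ _} _ eq = cong inj₁ (inj₁-injective eq)
  colour-label-injective {inj₂ (j , s)} {inj₂ (j′ , s′)} eqc eql
    with refl ← uncurry (ends-injective {j} {j′}) (,-injective (inj₂-injective eql)) =
    cong (λ s → inj₂ (j , s)) (other-injective (cx≢cy j) eqc)

  embed : Fin (v + size F * k) → Fin n
  embed z = g (colour (name z)) (label (name z))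

  embed-injective : Injective _≡_ _≡_ embed
  embed-injective eq = let eqc , eql = proj₁ (proj₂ grid) eq in name-injective (colour-label-injective eqc eql)

  embed-vertex : ∀ w → embed (vertex w) ≡ g (colour w) (label w)
  embed-vertex w = cong (λ w → g (colour w) (label w)) (name-vertex w)

  -- The edge of the grid that receives the `j`-th edge of F⁺: each colour is sent to the label of
  -- the vertex of that colour on the edge.
  transversal : Fin (size F) → Fin (2 + k) → Label v
  transversal j = choose (cx≢cy j) (inj₁ (x j)) (inj₁ (y j)) (inj₂ (x j , y j))

  transversal-x : ∀ j → transversal j (c (x j)) ≡ inj₁ (x j)
  transversal-x j = choose-first (cx≢cy j) (inj₁ (x j)) (inj₁ (y j)) (inj₂ (x j , y j))

  transversal-y : ∀ j → transversal j (c (y j)) ≡ inj₁ (y j)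
  transversal-y j = choose-second (cx≢cy j) (inj₁ (x j)) (inj₁ (y j)) (inj₂ (x j , y j))

  transversal-new : ∀ j s → transversal j (other (cx≢cy j) s) ≡ inj₂ (x j , y j)
  transversal-new j = choose-remaining (cx≢cy j) (inj₁ (x j)) (inj₁ (y j)) (inj₂ (x j , y j))

  -- Every colour occurs on the edge, at the label chosen by `σ` (`at`), and conversely every vertex
  -- of the edge has the label that `σ` assigns to its colour (`σ-label`).
  edge-image : ∀ j → ∃[ j′ ] IsImage embed (lookup (edges F) j ++ block (size F) k j) (lookup (edges H) j′)
  edge-image j = j′ , λ y → mk⇔ (preimage ∘ to (mem y)) (from (mem y) ∘ image)
    where
    e = lookup (edges F) j ++ block (size F) k j
    σ = transversal j
    j′ = proj₁ (proj₂ (proj₂ grid) σ)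
    mem = proj₂ (proj₂ (proj₂ grid) σ)

    place : ∀ w → vertex w ∈ₛ e → σ (colour w) ≡ label w →
            ∃[ z ] (z ∈ₛ e × embed z ≡ g (colour w) (σ (colour w)))
    place w w∈e eq = vertex w , w∈e , trans (embed-vertex w) (cong (g (colour w)) (sym eq))

    at : ∀ i → ∃[ z ] (z ∈ₛ e × embed z ≡ g i (σ i))
    at i with colourView (cx≢cy j) i
    ... | first       = place (inj₁ (x j)) (∈-old⁺ (lookup (edges F) j) j (end-∈ j zero)) (transversal-x j)
    ... | second      = place (inj₁ (y j)) (∈-old⁺ (lookup (edges F) j) j (end-∈ j (suc zero))) (transversal-y j)
    ... | remaining s = place (inj₂ (j , s)) (∈-new⁺ (lookup (edges F) j) j s) (transversal-new j s)

    preimage : ∀ {y} → ∃[ i ] g i (σ i) ≡ y → ∃[ z ] (z ∈ₛ e × embed z ≡ y)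
    preimage (i , refl) = at i

    σ-label : ∀ w → vertex w ∈ₛ e → σ (colour w) ≡ label w
    σ-label (inj₁ u) u∈e with to (proj₂ (proj₂ (enumerateEdge F j)) u) (∈-old⁻ (lookup (edges F) j) j u∈e)
    ... | zero     , refl = transversal-x j
    ... | suc zero , refl = transversal-y j
    σ-label (inj₂ (i , s)) ∈e with refl ← ∈-new⁻ (lookup (edges F) j) j ∈e = transversal-new j s

    image : ∀ {y} → ∃[ z ] (z ∈ₛ e × embed z ≡ y) → ∃[ i ] g i (σ i) ≡ y
    image (z , z∈e , refl) = colour (name z) ,
      cong (g (colour (name z))) (σ-label (name z) (subst (_∈ₛ e) (sym (vertex-name z)) z∈e))

  contains : Contains H (expansion 2≤r F)
  contains = embed , embed-injective , λ e∈ →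
    let j , eq = ∈-tabulate⁻ e∈
        j′ , img = edge-image j
    in lookup (edges H) j′ , ∈-lookup j′ , subst (λ e → IsImage embed e (lookup (edges H) j′)) (sym eq) img

-- The bound on the extremal number

no-vertices : (H : Hypergraph (suc r) 0) → size H ≤ 0
no-vertices H = ≮⇒≥ λ 0<size → Fin.¬Fin0 (proj₁ (enumerateEdge H (fromℕ< 0<size)) zero)

-- The factor `n` on the left of `count-box` cancels one factor of `n ^ (suc k * t ^ k)`, which
-- yields the `∸ 1` in the exponent.
size-bound : ∀ (H : Hypergraph (suc k) n) → ¬ Box t (suc k) (IsTuple H) →
             BoundedByPower (size H) (suc (boxConstant t k)) n (suc k * t ^ k ∸ 1) (t ^ k)
size-bound {k} {n} {t} H ¬box with t ^ k in t^k≡q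
-- Here the truncated exponent `0 ∸ 1` is `0`, and both sides are `1`.
... | zero rewrite *-zeroʳ k = ≤-refl
size-bound {k} {zero}  {t} H ¬box | suc q =
  ≤-trans (^-monoˡ-≤ (suc q) (no-vertices H)) z≤n
size-bound {k} {n@(suc _)} {t} H ¬box | suc q = *-cancelˡ-≤ n (begin
  n * size H ^ suc q                                   ≤⟨ *-monoʳ-≤ n (^-monoˡ-≤ (suc q) (size≤count H)) ⟩
  n * count (isTuple? H) (tuples n (suc k)) ^ suc q    ≤⟨ subst (λ q → n * count (isTuple? H) (tuples n (suc k)) ^ q ≤ K * (n ^ suc k) ^ q)
                                                            t^k≡q (count-box n t k (isTuple? H) ¬box) ⟩
  K * (n ^ suc k) ^ suc q                              ≡⟨ cong (K *_) (^-*-assoc n (suc k) (suc q)) ⟩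
  -- `BoundedByPower` raises the constant to the power `suc q`; as `suc K` is positive,
  -- `K ≤ suc K ≤ suc K ^ suc q`.
  K * (n * n ^ (q + k * suc q))                        ≤⟨ *-monoˡ-≤ _ (≤-trans (n≤1+n K) (m≤m*n (suc K) (suc K ^ q) {{m^n≢0 (suc K) q}})) ⟩
  suc K ^ suc q * (n * n ^ (q + k * suc q))            ≡⟨ regroup (suc K ^ suc q) n _ ⟩
  n * (suc K ^ suc q * n ^ (q + k * suc q))            ∎)
  where
  open ≤-Reasoning
  K = boxConstant t k
  regroup : ∀ a b c → a * (b * c) ≡ b * (a * c)
  regroup = solve-∀

Colourable-mono : ∀ {F : Graph v} {j k} → j ≤ k → Colourable F j → Colourable F k
Colourable-mono j≤k (c , proper) =
  (λ u → inject≤ (c u) j≤k) , λ e∈ x∈ y∈ x≢y → proper e∈ x∈ y∈ x≢y ∘ inject≤-injective j≤k j≤k _ _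

-- By Pascal's rule the binomial coefficient has `suc r` as a summand.
1≤rC2 : ∀ r → 1 ≤ (2 + r) C 2
1≤rC2 r = subst (1 ≤_) (nCk+nC[k+1]≡[n+1]C[k+1] (suc r) 1)
  (≤-trans (subst (1 ≤_) (sym (nC1≡n (suc r))) (s≤s z≤n)) (m≤m+n _ _))

theorem3p2 : ∀ (r : ℕ) (3≤r : 3 ≤ r) (v : ℕ) (F : Graph v) (χ : ℕ) → IsChromaticNumber F χ → χ ≤ r →
    let x = (r C 2) * v ^ 2 + v
        q = x ^ (r ∸ 1)
    in ∃[ c ] (0 < c × (∀ (n m : ℕ) → IsEx n (expansion (<⇒≤ 3≤r) F) m → BoundedByPower m c n (r * q ∸ 1) q))
theorem3p2 r@(suc (suc (suc k))) 3≤r@(s≤s (s≤s (s≤s _))) v F χ (colouring , _) χ≤r =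
  -- `2 + k` is `r ∸ 1`, and the successor makes the constant positive. A box in the F⁺-free `H` of
  -- size `m` would give a grid with parts indexed by labels, hence a copy of F⁺.
  suc (boxConstant x (2 + k)) , s≤s z≤n , λ { n m ((H , H-free , refl) , _) →
    size-bound {t = x} H λ box → H-free (Embedding.contains (<⇒≤ 3≤r) F H (Colourable-mono {F = F} χ≤r colouring)
      (Grid-↣ {H = H} (label-index _ v*v≤) (label-index-injective _ v*v≤) (box⇒grid H box))) }
  where
  x = (r C 2) * v ^ 2 + v
  v*v≤ : v * v ≤ (r C 2) * v ^ 2
  v*v≤ = begin
    v * v               ≡⟨ cong (v *_) (*-identityʳ v) ⟨
    v ^ 2               ≡⟨ *-identityˡ (v ^ 2) ⟨
    1 * v ^ 2           ≤⟨ *-monoˡ-≤ (v ^ 2) (1≤rC2 (suc k)) ⟩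
    (r C 2) * v ^ 2     ∎
    where open ≤-Reasoning
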